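{- (i) For every even $n$ and every integer $k$ with $4\le k\le n$, every one-factorization of $K_n$ has a set $S$ of $k$ vertices with deficit $D(S)\ge k-3$. (ii) For every integer $d\ge -2$ there are $C>0$ and $n_0$ such that for every even $n\ge n_0$, every one-factorization of $K_n$ has a set $S$ of $k\le C\log n$ vertices (for some $k\ge1$) with deficit $D(S)\ge k+d$.
   Context: A one-factorization of $K_n$ ($n$ even) is a proper edge-coloring of $K_n$ with $n-1$ colors, so each color class is a perfect matching. For a set $S$ of vertices, $\gamma(S)$ is the number of distinct colors appearing on edges with both endpoints in $S$, and the deficit of $S$ is $D(S)=\binom{|S|}{2}-\gamma(S)$. -}

module Defs where

open import Data.Fin using (Fin)
open import Data.Fin.Properties using (any?; _≟_)
open import Data.Fin.Subset using (Subset; _∈_; ∣_∣)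
open import Data.Fin.Subset.Properties using (_∈?_)
open import Data.Integer as ℤ using (ℤ; +_)
open import Data.Nat using (ℕ; _∸_)
open import Data.Nat.Combinatorics using (_C_)
open import Data.Product using (_×_; ∃-syntax)
open import Data.Vec using (tabulate)
open import Relation.Binary.PropositionalEquality using (_≡_; _≢_)
open import Relation.Nullary using (Dec; does; ¬?; _×-dec_)

-- The edge uv (u ≢ v) of K_n is coloured by colour u v.  The diagonal values
-- colour u u carry no meaning: every definition below ignores them, and for
-- even n > 0 the palette is nonempty, so they exclude no colouring.
-- That every colour class is a perfect matching follows, for even n, from
-- properness together with the size of the palette.
record OneFactorization (n : ℕ) : Set where
  field
    colour : Fin n → Fin n → Fin (n ∸ 1)
    symmetric : ∀ u v → colour u v ≡ colour v u
    proper : ∀ u v w → u ≢ v → u ≢ w → v ≢ w → colour u v ≢ colour u w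

module _ {n : ℕ} (F : OneFactorization n) where
  open OneFactorization F

  AppearsIn : Subset n → Fin (n ∸ 1) → Set
  AppearsIn S c = ∃[ u ] ∃[ v ] (u ∈ S × v ∈ S × u ≢ v × colour u v ≡ c)

  appearsIn? : ∀ S c → Dec (AppearsIn S c)
  appearsIn? S c = any? λ u → any? λ v →
    (u ∈? S) ×-dec (v ∈? S) ×-dec ¬? (u ≟ v) ×-dec (colour u v ≟ c)

  coloursIn : Subset n → Subset (n ∸ 1)
  coloursIn S = tabulate λ c → does (appearsIn? S c)

  γ : Subset n → ℕ
  γ S = ∣ coloursIn S ∣

  deficit : Subset n → ℤ
  deficit S = + (∣ S ∣ C 2) ℤ.- + γ S

{-# OPTIONS --safe #-}
module Submission where

-- Adding a vertex y to X raises the deficit by at least the number of edges from y to X whose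
-- colour already occurs inside X; call these links.  If X spans at least ∣ X ∣ colours, then
-- every vertex of X has a colour of X leading outside, so some y has a link; with fewer
-- colours the deficit is already large.  Growing X one vertex at a time gives (i).
--
-- For (ii), start from such an X with deficit below ∣ X ∣ + d; if X is large compared with d,
-- it has many colours.  Follow non-backtracking walks out of X along edges with colours of X:
-- if no vertex met within r steps ever had two links to what was already attached, the walks
-- would have 2 ^ r distinct endpoints, which is impossible once 2 ^ r > n.  So attaching
-- O(log n) vertices raises deficit minus size by one, and d + 3 rounds suffice.

open import Data.Fin using (Fin; zero; suc)
open import Data.Fin.Properties using (any?; _≟_; injective⇒≤)
open import Data.Fin.Subset
  using (Subset; inside; outside; _∈_; _∉_; _⊆_; ∣_∣; ⁅_⁆; ⊥; ⊤; _∪_; _─_; _-_; Nonempty)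
open import Data.Fin.Subset.Properties
open import Data.Nat using (ℕ; zero; suc; _+_; _∸_; _^_; _≤_; _<_; _*_; z≤n; s≤s; _≤?_; >-nonZero)
open import Data.Nat.Combinatorics using (_C_; nC1≡n; nCk+nC[k+1]≡[n+1]C[k+1])
open import Data.Nat.Logarithm using (⌊log₂_⌋; ⌊log₂⌋-mono-≤; ⌊log₂[2^n]⌋≡n)
open import Data.Nat.Properties hiding (_≟_)
open import Data.Nat.Tactic.RingSolver using (solve-∀)
open import Data.Product using (_×_; _,_; proj₁; proj₂; ∃-syntax)
open import Data.Sum using ([_,_]′; inj₁; inj₂)
open import Data.Vec using ([]; _∷_; here; there)
open import Data.Vec.Properties using ([]=⇒lookup; lookup⇒[]=; lookup∘tabulate)
open import Function using (_∘_; id)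
open import Relation.Binary.PropositionalEquality
  using (_≡_; _≢_; refl; sym; trans; cong; subst; ≢-sym; module ≡-Reasoning)
open import Relation.Nullary
  using (Dec; yes; no; ¬_; does; ¬?; _×-dec_; contradiction)
open import Relation.Nullary.Decidable using (decidable-stable; dec-true)
open import Defs

private
  variable
    m n : ℕ

-- Cardinalities of finite subsets

∣p∪q∣≡∣p∣+∣q∣ : (p q : Subset n) → (∀ {x} → x ∈ p → x ∉ q) →
                ∣ p ∪ q ∣ ≡ ∣ p ∣ + ∣ q ∣
∣p∪q∣≡∣p∣+∣q∣ [] [] _ = refl
∣p∪q∣≡∣p∣+∣q∣ (inside ∷ p) (inside ∷ q) p#q = contradiction here (p#q here)
∣p∪q∣≡∣p∣+∣q∣ (inside ∷ p) (outside ∷ q) p#q =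
  cong suc (∣p∪q∣≡∣p∣+∣q∣ p q λ x∈p x∈q → p#q (there x∈p) (there x∈q))
∣p∪q∣≡∣p∣+∣q∣ (outside ∷ p) (inside ∷ q) p#q =
  trans (cong suc (∣p∪q∣≡∣p∣+∣q∣ p q λ x∈p x∈q → p#q (there x∈p) (there x∈q)))
        (sym (+-suc ∣ p ∣ ∣ q ∣))
∣p∪q∣≡∣p∣+∣q∣ (outside ∷ p) (outside ∷ q) p#q =
  ∣p∪q∣≡∣p∣+∣q∣ p q λ x∈p x∈q → p#q (there x∈p) (there x∈q)

x∈p─q⇒x∉q : (p q : Subset n) → ∀ {x} → x ∈ p ─ q → x ∉ q
x∈p─q⇒x∉q (s ∷ p) (outside ∷ q) (there x∈p─q) (there x∈q) = x∈p─q⇒x∉q p q x∈p─q x∈q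
x∈p─q⇒x∉q (s ∷ p) (inside ∷ q) (there x∈p─q) (there x∈q) = x∈p─q⇒x∉q p q x∈p─q x∈q

∣p∣≤∣p─q∣+∣q∣ : (p q : Subset n) → ∣ p ∣ ≤ ∣ p ─ q ∣ + ∣ q ∣
∣p∣≤∣p─q∣+∣q∣ p q = begin
  ∣ p ∣             ≤⟨ p⊆q⇒∣p∣≤∣q∣ p⊆p─q∪q ⟩
  ∣ (p ─ q) ∪ q ∣   ≡⟨ ∣p∪q∣≡∣p∣+∣q∣ (p ─ q) q (x∈p─q⇒x∉q p q) ⟩
  ∣ p ─ q ∣ + ∣ q ∣ ∎
  where
  open ≤-Reasoning
  p⊆p─q∪q : p ⊆ (p ─ q) ∪ q
  p⊆p─q∪q {x} x∈p with x ∈? q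
  ... | yes x∈q = x∈p∪q⁺ (inj₂ x∈q)
  ... | no x∉q = x∈p∪q⁺ (inj₁ (x∈p∧x∉q⇒x∈p─q x∈p x∉q))

∣p─q∣+∣q∣≤∣p∣ : (p q : Subset n) → q ⊆ p → ∣ p ─ q ∣ + ∣ q ∣ ≤ ∣ p ∣
∣p─q∣+∣q∣≤∣p∣ p q q⊆p = begin
  ∣ p ─ q ∣ + ∣ q ∣ ≡⟨ ∣p∪q∣≡∣p∣+∣q∣ (p ─ q) q (x∈p─q⇒x∉q p q) ⟨
  ∣ (p ─ q) ∪ q ∣   ≤⟨ p⊆q⇒∣p∣≤∣q∣ ([ p─q⊆p p q , q⊆p ]′ ∘ x∈p∪q⁻ (p ─ q) q) ⟩
  ∣ p ∣             ∎
  where open ≤-Reasoning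

x∈p∪⁅x⁆ : (p : Subset n) (x : Fin n) → x ∈ p ∪ ⁅ x ⁆
x∈p∪⁅x⁆ p x = q⊆p∪q p ⁅ x ⁆ (x∈⁅x⁆ x)

x∉p∪⁅y⁆ : (p : Subset n) {x y : Fin n} → x ∉ p → x ≢ y → x ∉ p ∪ ⁅ y ⁆
x∉p∪⁅y⁆ p {y = y} x∉p x≢y = [ x∉p , x≢y⇒x∉⁅y⁆ x≢y ]′ ∘ x∈p∪q⁻ p ⁅ y ⁆

∣p∪⁅x⁆∣≡1+∣p∣ : (p : Subset n) {x : Fin n} → x ∉ p → ∣ p ∪ ⁅ x ⁆ ∣ ≡ suc ∣ p ∣
∣p∪⁅x⁆∣≡1+∣p∣ p {x} x∉p = begin
  ∣ p ∪ ⁅ x ⁆ ∣     ≡⟨ ∣p∪q∣≡∣p∣+∣q∣ p ⁅ x ⁆ (λ y∈p y∈⁅x⁆ → x∉p (subst (_∈ p) (x∈⁅y⁆⇒x≡y x y∈⁅x⁆) y∈p)) ⟩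
  ∣ p ∣ + ∣ ⁅ x ⁆ ∣ ≡⟨ cong (∣ p ∣ +_) (∣⁅x⁆∣≡1 x) ⟩
  ∣ p ∣ + 1         ≡⟨ +-comm ∣ p ∣ 1 ⟩
  suc ∣ p ∣         ∎
  where open ≡-Reasoning

∣⁅x⁆∪⁅y⁆∣≡2 : {x y : Fin n} → y ≢ x → ∣ ⁅ x ⁆ ∪ ⁅ y ⁆ ∣ ≡ 2
∣⁅x⁆∪⁅y⁆∣≡2 {x = x} y≢x =
  trans (∣p∪⁅x⁆∣≡1+∣p∣ ⁅ x ⁆ (x≢y⇒x∉⁅y⁆ y≢x)) (cong suc (∣⁅x⁆∣≡1 x))

covered⇒∣q∣≤∣p∣ : (f : Fin m → Fin n) (p : Subset m) (q : Subset n) →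
                  (∀ {y} → y ∈ q → ∃[ x ] (x ∈ p × f x ≡ y)) → ∣ q ∣ ≤ ∣ p ∣
covered⇒∣q∣≤∣p∣ {n = n} f [] q cover
  rewrite Empty-unique {p = q} (λ (_ , y∈q) → contradiction (proj₁ (cover y∈q)) λ ()) =
  ≤-reflexive (∣⊥∣≡0 n)
covered⇒∣q∣≤∣p∣ f (outside ∷ p) q cover = covered⇒∣q∣≤∣p∣ (f ∘ suc) p q cover′
  where
  cover′ : ∀ {y} → y ∈ q → ∃[ x ] (x ∈ p × f (suc x) ≡ y)
  cover′ y∈q with cover y∈q
  ... | suc x , there x∈p , fx≡y = x , x∈p , fx≡y
covered⇒∣q∣≤∣p∣ f (inside ∷ p) q cover = begin
  ∣ q ∣                              ≤⟨ ∣p∣≤∣p─q∣+∣q∣ q ⁅ f zero ⁆ ⟩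
  ∣ q - f zero ∣ + ∣ ⁅ f zero ⁆ ∣    ≡⟨ cong (∣ q - f zero ∣ +_) (∣⁅x⁆∣≡1 (f zero)) ⟩
  ∣ q - f zero ∣ + 1                 ≡⟨ +-comm _ 1 ⟩
  suc ∣ q - f zero ∣                 ≤⟨ s≤s (covered⇒∣q∣≤∣p∣ (f ∘ suc) p (q - f zero) cover′) ⟩
  suc ∣ p ∣                          ∎
  where
  open ≤-Reasoning
  cover′ : ∀ {y} → y ∈ q - f zero → ∃[ x ] (x ∈ p × f (suc x) ≡ y)
  cover′ y∈ with cover (p─q⊆p q ⁅ f zero ⁆ y∈)
  ... | suc x , there x∈p , fx≡y = x , x∈p , fx≡y
  ... | zero , here , refl = contradiction (x∈⁅x⁆ (f zero)) (x∈p─q⇒x∉q q ⁅ f zero ⁆ y∈)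

missed-value : (f : Fin m → Fin n) (p : Subset m) (q : Subset n) → ∣ p ∣ < ∣ q ∣ →
               ∃[ y ] (y ∈ q × (∀ {x} → x ∈ p → f x ≢ y))
missed-value f p q ∣p∣<∣q∣
  with any? (λ y → (y ∈? q) ×-dec ¬? (any? (λ x → (x ∈? p) ×-dec (f x ≟ y))))
... | yes (y , y∈q , missed) = y , y∈q , λ x∈p fx≡y → missed (_ , x∈p , fx≡y)
... | no ∄missed = contradiction ∣p∣<∣q∣ (≤⇒≯ (covered⇒∣q∣≤∣p∣ f p q λ {y} y∈q →
  decidable-stable (any? λ x → (x ∈? p) ×-dec (f x ≟ y)) λ missed → ∄missed (y , y∈q , missed)))

∣p∣<n⇒∃x∉p : (p : Subset n) → ∣ p ∣ < n → ∃[ x ] x ∉ p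
∣p∣<n⇒∃x∉p {n} p ∣p∣<n with missed-value id p ⊤ (<-≤-trans ∣p∣<n (≤-reflexive (sym (∣⊤∣≡n n))))
... | x , _ , missed = x , λ x∈p → missed x∈p refl

-- Trees of non-backtracking walks

module _ {n : ℕ} (Adj : Fin n → Fin n → Set) where

  data Attached (S : Subset n) : ℕ → Subset n → Set where
    start  : Attached S 0 S
    attach : ∀ {i X u y} → Attached S i X → y ∉ X → u ∈ X → Adj u y → Attached S (suc i) (X ∪ ⁅ y ⁆)

  -- Walk p v r x: a walk of r edges from v to x which never turns back, and whose first
  -- step does not go to p.
  data Walk : Fin n → Fin n → ℕ → Fin n → Set where
    stop : ∀ {p v} → Walk p v 0 v
    step : ∀ {p v w r x} → Adj v w → w ≢ p → Walk v w r x → Walk p v (suc r) x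

  module _
    (adj-irrefl : ∀ {u} → ¬ Adj u u)
    (adj-sym : ∀ {u v} → Adj u v → Adj v u)
    (two-onward : ∀ p v → ∃[ a ] ∃[ b ] (a ≢ p × b ≢ p × b ≢ a × Adj v a × Adj v b))
    (S : Subset n) (M : ℕ)
    (unique-link : ∀ {i X y u v} → Attached S i X → i < M → y ∉ X →
                   u ∈ X → v ∈ X → Adj u y → Adj v y → u ≡ v)
    where

    -- A neighbour `w` of `v` inside `X` would be a second link besides `p`, so `unique-link` would
    -- force `w ≡ p`.
    onward∉ : ∀ {i X p v w} → Attached S i X → i < M → p ∈ X → v ∉ X → Adj p v →
              Adj v w → w ≢ p → w ∉ X ∪ ⁅ v ⁆
    onward∉ {X = X} att i<M p∈X v∉X pv vw w≢p = x∉p∪⁅y⁆ X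
      (λ w∈X → w≢p (unique-link att i<M v∉X w∈X p∈X (adj-sym vw) pv))
      (λ { refl → adj-irrefl vw })

    -- Attach the vertices of the walk one at a time: `onward∉` keeps the next one outside the grown
    -- set. Each step spends one attachment, hence the budget `i + r < M`.
    walk-leaves : ∀ {i X p v r x} → Attached S i X → i + r < M → p ∈ X → v ∉ X → Adj p v →
                  Walk p v r x → x ∉ X
    walk-leaves att _ p∈X v∉X pv stop = v∉X
    walk-leaves {i} {X} {v = v} att bound p∈X v∉X pv (step {r = r} vw w≢p walk) =
      walk-leaves (attach att v∉X p∈X pv) (subst (_< M) (+-suc i r) bound) (x∈p∪⁅x⁆ X v)
        (onward∉ att (≤-<-trans (m≤m+n i _) bound) p∈X v∉X pv vw w≢p) vw walk
      ∘ p⊆p∪q ⁅ v ⁆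

    -- Here `b` is the root of a sibling branch, which has to stay unattached. If the walk stepped
    -- from `v` to `b`, then `b` would have links to both `q` and `v`, giving `q ≡ v` although
    -- `q ∈ X` and `v ∉ X`.
    attach-walk : ∀ {i X p v r x q b} → Attached S i X → i + r < M → p ∈ X → v ∉ X → Adj p v →
                  q ∈ X → b ∉ X → Adj q b → b ≢ v → Walk p v r x →
                  ∃[ Y ] (Attached S (r + suc i) Y × X ⊆ Y × x ∈ Y × b ∉ Y)
    attach-walk {X = X} {v = v} att _ p∈X v∉X pv q∈X b∉X qb b≢v stop =
      X ∪ ⁅ v ⁆ , attach att v∉X p∈X pv , p⊆p∪q ⁅ v ⁆ , x∈p∪⁅x⁆ X v , x∉p∪⁅y⁆ X b∉X b≢v
    attach-walk {i} {X} {v = v} att bound p∈X v∉X pv q∈X b∉X qb b≢v (step {w = w} {r = r} vw w≢p walk)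
      with attach-walk att′ bound′ (x∈p∪⁅x⁆ X v)
             (onward∉ att (≤-<-trans (m≤m+n i _) bound) p∈X v∉X pv vw w≢p) vw
             (p⊆p∪q ⁅ v ⁆ q∈X) b∉X′ qb b≢w walk
      where
      att′ : Attached S (suc i) (X ∪ ⁅ v ⁆)
      att′ = attach att v∉X p∈X pv
      bound′ : suc i + r < M
      bound′ = subst (_< M) (+-suc i r) bound
      b∉X′ : _ ∉ X ∪ ⁅ v ⁆
      b∉X′ = x∉p∪⁅y⁆ X b∉X b≢v
      b≢w : _ ≢ w
      b≢w refl = v∉X (subst (_∈ X)
        (unique-link att′ (≤-<-trans (m≤m+n (suc i) r) bound′) b∉X′
          (p⊆p∪q ⁅ v ⁆ q∈X) (x∈p∪⁅x⁆ X v) qb vw) q∈X)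
    ... | Y , attY , X′⊆Y , x∈Y , b∉Y =
      Y , subst (λ j → Attached S j Y) (+-suc r (suc i)) attY , X′⊆Y ∘ p⊆p∪q ⁅ v ⁆ , x∈Y , b∉Y

    -- The two subtrees below v are disjoint: attach a whole walk through a; then b is still
    -- outside, and a walk through b can never come back.
    walk-endpoints : ∀ r {i X p v} → Attached S i X → i + (r + r) < M → p ∈ X → v ∉ X → Adj p v →
                     ∃[ R ] (2 ^ r ≤ ∣ R ∣ × (∀ {x} → x ∈ R → Walk p v r x))
    walk-endpoints zero {v = v} _ _ _ _ _ =
      ⁅ v ⁆ , ≤-reflexive (sym (∣⁅x⁆∣≡1 v)) ,
      λ x∈⁅v⁆ → subst (Walk _ v 0) (sym (x∈⁅y⁆⇒x≡y v x∈⁅v⁆)) stop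
    walk-endpoints (suc r) {i} {X} {p} {v} att bound p∈X v∉X pv
      with two-onward p v
    ... | a , b , a≢p , b≢p , b≢a , va , vb = Ra ∪ Rb , size , walks
      where
      i<M : i < M
      i<M = ≤-<-trans (m≤m+n i _) bound
      -- Attaching `v` and the `suc r` vertices of a walk through `a` brings the count to
      -- `r + suc (suc i)`; the walk through `b` takes up to `r` more. The total is exactly
      -- `i + (suc r + suc r)`, which is why the budget doubles `r`.
      bound₂ : (r + suc (suc i)) + r < M
      bound₂ = subst (_< M) (lemma i r) bound
        where
        lemma : ∀ i r → i + (suc r + suc r) ≡ (r + suc (suc i)) + r
        lemma = solve-∀
      bound₁ : suc i + (r + r) < M
      bound₁ = ≤-<-trans (≤-trans (n≤1+n _) (≤-reflexive (lemma i r))) bound₂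
        where
        lemma : ∀ i r → suc (suc i + (r + r)) ≡ (r + suc (suc i)) + r
        lemma = solve-∀
      att′ : Attached S (suc i) (X ∪ ⁅ v ⁆)
      att′ = attach att v∉X p∈X pv
      v∈X′ : v ∈ X ∪ ⁅ v ⁆
      v∈X′ = x∈p∪⁅x⁆ X v
      a∉X′ : a ∉ X ∪ ⁅ v ⁆
      a∉X′ = onward∉ att i<M p∈X v∉X pv va a≢p
      b∉X′ : b ∉ X ∪ ⁅ v ⁆
      b∉X′ = onward∉ att i<M p∈X v∉X pv vb b≢p
      IHa = walk-endpoints r att′ bound₁ v∈X′ a∉X′ va
      IHb = walk-endpoints r att′ bound₁ v∈X′ b∉X′ vb
      Ra Rb : Subset n
      Ra = proj₁ IHa
      Rb = proj₁ IHb
      disjoint : ∀ {x} → x ∈ Ra → x ∉ Rb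
      disjoint x∈Ra x∈Rb
        with attach-walk att′ (≤-<-trans (+-monoʳ-≤ (suc i) (m≤m+n r r)) bound₁)
               v∈X′ a∉X′ va v∈X′ b∉X′ vb b≢a (proj₂ (proj₂ IHa) x∈Ra)
      ... | Y , attY , X′⊆Y , x∈Y , b∉Y =
        walk-leaves attY bound₂ (X′⊆Y v∈X′) b∉Y vb (proj₂ (proj₂ IHb) x∈Rb) x∈Y
      size : 2 ^ suc r ≤ ∣ Ra ∪ Rb ∣
      size = begin
        2 ^ r + (2 ^ r + 0)   ≡⟨ cong (2 ^ r +_) (+-identityʳ (2 ^ r)) ⟩
        2 ^ r + 2 ^ r         ≤⟨ +-mono-≤ (proj₁ (proj₂ IHa)) (proj₁ (proj₂ IHb)) ⟩
        ∣ Ra ∣ + ∣ Rb ∣       ≡⟨ ∣p∪q∣≡∣p∣+∣q∣ Ra Rb disjoint ⟨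
        ∣ Ra ∪ Rb ∣           ∎
        where open ≤-Reasoning
      walks : ∀ {x} → x ∈ Ra ∪ Rb → Walk p v (suc r) x
      walks x∈ with x∈p∪q⁻ Ra Rb x∈
      ... | inj₁ x∈Ra = step va a≢p (proj₂ (proj₂ IHa) x∈Ra)
      ... | inj₂ x∈Rb = step vb b≢p (proj₂ (proj₂ IHb) x∈Rb)

-- Surpluses of vertex sets

[1+k]C2≡k+kC2 : ∀ k → suc k C 2 ≡ k + k C 2
[1+k]C2≡k+kC2 k = trans (sym (nCk+nC[k+1]≡[n+1]C[k+1] k 1)) (cong (_+ k C 2) (nC1≡n k))

-- The difference of the two sides is `(k - 2)(k - 3) / 2`, which is nonnegative at integers and
-- zero at 2 and 3. This is the source of the 3 in `k - 3`.
2k≤kC2+3 : ∀ k → k + k ≤ k C 2 + 3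
2k≤kC2+3 0 = z≤n
2k≤kC2+3 1 = s≤s (s≤s z≤n)
2k≤kC2+3 2 = ≤-refl
2k≤kC2+3 (suc k@(suc (suc j))) = begin
  suc k + suc k       ≡⟨ cong suc (+-suc k k) ⟩
  2 + (k + k)         ≤⟨ +-mono-≤ (m≤m+n 2 j) (2k≤kC2+3 k) ⟩
  k + (k C 2 + 3)     ≡⟨ +-assoc k (k C 2) 3 ⟨
  (k + k C 2) + 3     ≡⟨ cong (_+ 3) ([1+k]C2≡k+kC2 k) ⟨
  suc k C 2 + 3       ∎
  where open ≤-Reasoning

-- Equality holds at 7, where `(k - 1) / 2` reaches 3; the starting size `7 + a` comes from here.
3k≤kC2 : ∀ {k} → 7 ≤ k → 3 * k ≤ k C 2
3k≤kC2 7≤k with m≤n⇒∃[o]m+o≡n 7≤k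
... | j , refl = from-7 j
  where
  from-7 : ∀ j → 3 * (7 + j) ≤ (7 + j) C 2
  from-7 zero = ≤-refl
  from-7 (suc j) = begin
    3 * suc (7 + j)           ≡⟨ *-suc 3 (7 + j) ⟩
    3 + 3 * (7 + j)           ≤⟨ +-mono-≤ (m≤m+n 3 (4 + j)) (from-7 j) ⟩
    (7 + j) + (7 + j) C 2     ≡⟨ [1+k]C2≡k+kC2 (7 + j) ⟨
    suc (7 + j) C 2           ∎
    where open ≤-Reasoning

-- Colours spanned by a set, and growth by one vertex

module _ {n : ℕ} (F : OneFactorization n) where
  open OneFactorization F

  private
    Γ : Subset n → Subset (n ∸ 1)
    Γ = coloursIn F

  ∈coloursIn⁺ : ∀ {X c} → AppearsIn F X c → c ∈ Γ X
  ∈coloursIn⁺ {X} {c} app = lookup⇒[]= c (Γ X)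
    (trans (lookup∘tabulate _ c) (dec-true (appearsIn? F X c) app))

  ∈coloursIn⁻ : ∀ {X c} → c ∈ Γ X → AppearsIn F X c
  ∈coloursIn⁻ {X} {c} c∈ΓX = extract (appearsIn? F X c)
    (trans (sym (lookup∘tabulate _ c)) ([]=⇒lookup c∈ΓX))
    where
    extract : ∀ {A : Set} (A? : Dec A) → does A? ≡ inside → A
    extract (yes a) _ = a

  coloursIn-mono : ∀ {X Y} → X ⊆ Y → Γ X ⊆ Γ Y
  coloursIn-mono X⊆Y c∈ΓX with ∈coloursIn⁻ c∈ΓX
  ... | u , v , u∈X , v∈X , u≢v , uv = ∈coloursIn⁺ (u , v , X⊆Y u∈X , X⊆Y v∈X , u≢v , uv)

  -- Edges from `y` to `U` only repeat colours, so every new colour is seen on an edge from `y` to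
  -- `X ─ U`.
  γ-∪⁅y⁆ : ∀ X U {y} → U ⊆ X → (∀ {u} → u ∈ U → colour y u ∈ Γ X) →
           γ F (X ∪ ⁅ y ⁆) + ∣ U ∣ ≤ γ F X + ∣ X ∣
  γ-∪⁅y⁆ X U {y} U⊆X repeated = begin
    ∣ Γ X′ ∣ + ∣ U ∣                    ≤⟨ +-monoˡ-≤ ∣ U ∣ (∣p∣≤∣p─q∣+∣q∣ (Γ X′) (Γ X)) ⟩
    ∣ Γ X′ ─ Γ X ∣ + ∣ Γ X ∣ + ∣ U ∣    ≤⟨ +-monoˡ-≤ ∣ U ∣ (+-monoˡ-≤ ∣ Γ X ∣ new-colours) ⟩
    ∣ X ─ U ∣ + ∣ Γ X ∣ + ∣ U ∣         ≡⟨ lemma (∣ X ─ U ∣) (∣ Γ X ∣) (∣ U ∣) ⟩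
    ∣ Γ X ∣ + (∣ X ─ U ∣ + ∣ U ∣)       ≤⟨ +-monoʳ-≤ ∣ Γ X ∣ (∣p─q∣+∣q∣≤∣p∣ X U U⊆X) ⟩
    ∣ Γ X ∣ + ∣ X ∣                     ∎
    where
    open ≤-Reasoning
    X′ = X ∪ ⁅ y ⁆
    lemma : ∀ a b c → a + b + c ≡ b + (a + c)
    lemma = solve-∀
    not-repeated : ∀ {v} → v ∈ X → colour y v ∈ Γ X′ ─ Γ X → v ∈ X ─ U
    not-repeated v∈X new =
      x∈p∧x∉q⇒x∈p─q v∈X λ v∈U → x∈p─q⇒x∉q (Γ X′) (Γ X) new (repeated v∈U)
    cover : ∀ {c} → c ∈ Γ X′ ─ Γ X → ∃[ v ] (v ∈ X ─ U × colour y v ≡ c)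
    cover new with ∈coloursIn⁻ (p─q⊆p (Γ X′) (Γ X) new)
    ... | u , v , u∈X′ , v∈X′ , u≢v , refl with x∈p∪q⁻ X ⁅ y ⁆ u∈X′ | x∈p∪q⁻ X ⁅ y ⁆ v∈X′
    ... | inj₁ u∈X | inj₁ v∈X =
      contradiction (∈coloursIn⁺ (u , v , u∈X , v∈X , u≢v , refl)) (x∈p─q⇒x∉q (Γ X′) (Γ X) new)
    ... | inj₂ u∈⁅y⁆ | inj₂ v∈⁅y⁆ =
      contradiction (trans (x∈⁅y⁆⇒x≡y y u∈⁅y⁆) (sym (x∈⁅y⁆⇒x≡y y v∈⁅y⁆))) u≢v
    ... | inj₂ u∈⁅y⁆ | inj₁ v∈X rewrite x∈⁅y⁆⇒x≡y y u∈⁅y⁆ = v , not-repeated v∈X new , refl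
    ... | inj₁ u∈X | inj₂ v∈⁅y⁆ rewrite x∈⁅y⁆⇒x≡y y v∈⁅y⁆ | symmetric u y =
      u , not-repeated u∈X new , refl
    new-colours : ∣ Γ X′ ─ Γ X ∣ ≤ ∣ X ─ U ∣
    new-colours = covered⇒∣q∣≤∣p∣ (colour y) (X ─ U) (Γ X′ ─ Γ X) cover

  -- If colour c were missing at u, then v ↦ colour u v together with u ↦ c would inject
  -- n vertices into n ∸ 1 colours.
  partner : ∀ u c → ∃[ v ] (u ≢ v × colour u v ≡ c)
  partner u c with any? (λ v → ¬? (u ≟ v) ×-dec (colour u v ≟ c))
  ... | yes p = p
  ... | no missing = contradiction (injective⇒≤ f-injective) (<⇒≱ (pred-< u))
    where
    pred-< : ∀ {n} → Fin n → n ∸ 1 < n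
    pred-< zero = n<1+n _
    pred-< (suc _) = n<1+n _
    f : Fin n → Fin (n ∸ 1)
    f v with u ≟ v
    ... | yes _ = c
    ... | no _ = colour u v
    f-injective : ∀ {v w} → f v ≡ f w → v ≡ w
    f-injective {v} {w} fv≡fw with u ≟ v | u ≟ w
    ... | yes refl | yes refl = refl
    ... | yes _ | no u≢w = contradiction (w , u≢w , sym fv≡fw) missing
    ... | no u≢v | yes _ = contradiction (v , u≢v , fv≡fw) missing
    ... | no u≢v | no u≢w = decidable-stable (v ≟ w) λ v≢w → proper u v w u≢v u≢w v≢w fv≡fw

  -- Deficit at least ∣ X ∣ + a - 3, with all terms moved so that no subtraction occurs.
  Surplus : ℕ → Subset n → Set
  Surplus a X = γ F X + (∣ X ∣ + a) ≤ ∣ X ∣ C 2 + 3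

  surplus? : ∀ a X → Dec (Surplus a X)
  surplus? a X = γ F X + (∣ X ∣ + a) ≤? ∣ X ∣ C 2 + 3

  -- With `k = ∣ X ∣`, the binomial gains `k`, the colours gain at most `k - (i + 1)`, and the size
  -- gains one. So one link pays for the new vertex and each further link is profit.
  surplus-∪⁅y⁆ : ∀ {a X y} i U → Surplus a X → y ∉ X → ∣ U ∣ ≡ suc i → U ⊆ X →
                 (∀ {u} → u ∈ U → colour y u ∈ Γ X) → Surplus (i + a) (X ∪ ⁅ y ⁆)
  surplus-∪⁅y⁆ {a} {X} {y} i U surplus y∉X ∣U∣≡1+i U⊆X repeated
    rewrite ∣p∪⁅x⁆∣≡1+∣p∣ X y∉X = begin
    g′ + (suc k + (i + a))  ≡⟨ lemma g′ k i a ⟩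
    (g′ + suc i) + (k + a)  ≤⟨ +-monoˡ-≤ (k + a) (subst (λ j → g′ + j ≤ g + k) ∣U∣≡1+i
                                 (γ-∪⁅y⁆ X U U⊆X repeated)) ⟩
    (g + k) + (k + a)       ≡⟨ lemma′ g k a ⟩
    k + (g + (k + a))       ≤⟨ +-monoʳ-≤ k surplus ⟩
    k + (k C 2 + 3)         ≡⟨ +-assoc k (k C 2) 3 ⟨
    (k + k C 2) + 3         ≡⟨ cong (_+ 3) ([1+k]C2≡k+kC2 k) ⟨
    suc k C 2 + 3           ∎
    where
    open ≤-Reasoning
    k = ∣ X ∣
    g = γ F X
    g′ = γ F (X ∪ ⁅ y ⁆)
    lemma : ∀ g k i a → g + (suc k + (i + a)) ≡ (g + suc i) + (k + a)
    lemma = solve-∀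
    lemma′ : ∀ g k a → (g + k) + (k + a) ≡ k + (g + (k + a))
    lemma′ = solve-∀

  surplus-link : ∀ {a X u y} → Surplus a X → y ∉ X → u ∈ X → colour u y ∈ Γ X →
                 Surplus a (X ∪ ⁅ y ⁆)
  surplus-link {X = X} {u} {y} surplus y∉X u∈X uy∈ΓX =
    surplus-∪⁅y⁆ 0 ⁅ u ⁆ surplus y∉X (∣⁅x⁆∣≡1 u)
      (λ w∈ → subst (_∈ X) (sym (x∈⁅y⁆⇒x≡y u w∈)) u∈X)
      (λ w∈ → subst (λ w → colour y w ∈ Γ X) (sym (x∈⁅y⁆⇒x≡y u w∈))
        (subst (_∈ Γ X) (symmetric u y) uy∈ΓX))

  surplus-double-link : ∀ {a X u v y} → Surplus a X → y ∉ X → u ∈ X → v ∈ X → v ≢ u →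
                        colour u y ∈ Γ X → colour v y ∈ Γ X → Surplus (suc a) (X ∪ ⁅ y ⁆)
  surplus-double-link {X = X} {u} {v} {y} surplus y∉X u∈X v∈X v≢u uy∈ΓX vy∈ΓX =
    surplus-∪⁅y⁆ 1 (⁅ u ⁆ ∪ ⁅ v ⁆) surplus y∉X (∣⁅x⁆∪⁅y⁆∣≡2 v≢u)
      (λ w∈ → elim (_∈ X) u∈X v∈X w∈)
      (λ w∈ → elim (λ w → colour y w ∈ Γ X) (subst (_∈ Γ X) (symmetric u y) uy∈ΓX)
        (subst (_∈ Γ X) (symmetric v y) vy∈ΓX) w∈)
    where
    elim : (P : Fin n → Set) → P u → P v → ∀ {w} → w ∈ ⁅ u ⁆ ∪ ⁅ v ⁆ → P w
    elim P pu pv w∈ with x∈p∪q⁻ ⁅ u ⁆ ⁅ v ⁆ w∈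
    ... | inj₁ w∈⁅u⁆ = subst P (sym (x∈⁅y⁆⇒x≡y u w∈⁅u⁆)) pu
    ... | inj₂ w∈⁅v⁆ = subst P (sym (x∈⁅y⁆⇒x≡y v w∈⁅v⁆)) pv

  -- The other vertices of `X` are fewer than its colours, so some colour of `X` is on no edge from
  -- `u` within `X`; the partner of `u` in that colour lies outside.
  escape : ∀ {X u} → u ∈ X → ∣ X ∣ ≤ γ F X →
           ∃[ y ] (y ∉ X × u ≢ y × colour u y ∈ Γ X)
  escape {X} {u} u∈X ∣X∣≤γ
    with missed-value (colour u) (X - u) (Γ X) (<-≤-trans (x∈p⇒∣p-x∣<∣p∣ u∈X) ∣X∣≤γ)
  ... | c , c∈Γ , missed with partner u c
  ... | y , u≢y , refl =
    y , (λ y∈X → missed (x∈p∧x≢y⇒x∈p-y y∈X (≢-sym u≢y)) refl) , u≢y , c∈Γ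

  surplus-grow : ∀ {X u} → u ∈ X → Surplus 0 X → ∣ X ∣ < n →
                 ∃[ y ] (y ∉ X × Surplus 0 (X ∪ ⁅ y ⁆))
  surplus-grow {X} {u} u∈X surplus ∣X∣<n with ∣ X ∣ ≤? γ F X
  ... | yes ∣X∣≤γ with escape u∈X ∣X∣≤γ
  ...   | y , y∉X , _ , uy∈Γ = y , y∉X , surplus-link surplus y∉X u∈X uy∈Γ
  -- With fewer colours than vertices any outside vertex will do, even if all its edges bring new
  -- colours: `g < k` leaves only `3k ≤ k + (k C 2 + 3)` to check.
  surplus-grow {X} {u} u∈X surplus ∣X∣<n | no ∣X∣≰γ with ∣p∣<n⇒∃x∉p X ∣X∣<n
  ... | y , y∉X = y , y∉X , surplus′
    where
    open ≤-Reasoning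
    k = ∣ X ∣
    g = γ F X
    g′ = γ F (X ∪ ⁅ y ⁆)
    g′≤g+k : g′ + 0 ≤ g + k
    g′≤g+k = subst (λ j → g′ + j ≤ g + k) (∣⊥∣≡0 n)
      (γ-∪⁅y⁆ X ⊥ ⊥⊆ (λ u∈⊥ → contradiction u∈⊥ ∉⊥))
    lemma : ∀ g k → g + (suc k + 0) ≡ k + suc (g + 0)
    lemma = solve-∀
    surplus′ : Surplus 0 (X ∪ ⁅ y ⁆)
    surplus′ rewrite ∣p∪⁅x⁆∣≡1+∣p∣ X y∉X = begin
      g′ + (suc k + 0)        ≡⟨ lemma g′ k ⟩
      k + suc (g′ + 0)        ≤⟨ +-monoʳ-≤ k (s≤s g′≤g+k) ⟩
      k + (suc g + k)         ≤⟨ +-monoʳ-≤ k (+-monoˡ-≤ k (≰⇒> ∣X∣≰γ)) ⟩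
      k + (k + k)             ≤⟨ +-monoʳ-≤ k (2k≤kC2+3 k) ⟩
      k + (k C 2 + 3)         ≡⟨ +-assoc k (k C 2) 3 ⟨
      (k + k C 2) + 3         ≡⟨ cong (_+ 3) ([1+k]C2≡k+kC2 k) ⟨
      suc k C 2 + 3           ∎

  -- Abstract, so that it does not unfold at open numerals such as 6 + a.
  abstract
    surplus-of-size : ∀ k → suc k ≤ n → ∃[ X ] (∣ X ∣ ≡ suc k × Nonempty X × Surplus 0 X)
    surplus-of-size zero 0<n
      with ∣p∣<n⇒∃x∉p (⊥ {n}) (subst (_< n) (sym (∣⊥∣≡0 n)) 0<n)
    ... | u , _ = ⁅ u ⁆ , ∣⁅x⁆∣≡1 u , (u , x∈⁅x⁆ u) , surplus
      where
      no-edge : ∀ {c} → c ∈ Γ ⁅ u ⁆ → ∃[ v ] (v ∈ ⁅ u ⁆ × colour u v ≡ c)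
      no-edge c∈Γ with ∈coloursIn⁻ c∈Γ
      ... | x , y , x∈ , y∈ , x≢y , _ =
        contradiction (trans (x∈⁅y⁆⇒x≡y u x∈) (sym (x∈⁅y⁆⇒x≡y u y∈))) x≢y
      -- A singleton spans no colour; this cruder bound follows from the covering lemma and still
      -- suffices, as `1 + 1 ≤ 3`.
      γ≤1 : γ F ⁅ u ⁆ ≤ 1
      γ≤1 = subst (γ F ⁅ u ⁆ ≤_) (∣⁅x⁆∣≡1 u) (covered⇒∣q∣≤∣p∣ (colour u) ⁅ u ⁆ (Γ ⁅ u ⁆) no-edge)
      surplus : Surplus 0 ⁅ u ⁆
      surplus rewrite ∣⁅x⁆∣≡1 u = ≤-trans (+-monoˡ-≤ 1 γ≤1) (s≤s (s≤s z≤n))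
    surplus-of-size (suc k) 1+k<n with surplus-of-size k (<⇒≤ 1+k<n)
    ... | X , ∣X∣≡1+k , (u , u∈X) , surplus
      with surplus-grow u∈X surplus (subst (_< n) (sym ∣X∣≡1+k) 1+k<n)
    ... | y , y∉X , surplus′ =
      X ∪ ⁅ y ⁆ , trans (∣p∪⁅x⁆∣≡1+∣p∣ X y∉X) (cong suc ∣X∣≡1+k) , (y , x∈p∪⁅x⁆ X y) , surplus′

  -- Raising the surplus along edges with colours of a fixed set

  module _ (S : Subset n) where

    -- The union of the perfect matchings whose colours occur in `S`, a `γ F S`-regular graph. The
    -- colours stay those of `S` while sets grow, so the walks live in one fixed graph.
    Adj : Fin n → Fin n → Set
    Adj u v = u ≢ v × colour u v ∈ Γ S

    adj-sym : ∀ {u v} → Adj u v → Adj v u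
    adj-sym {u} {v} (u≢v , uv∈Γ) = ≢-sym u≢v , subst (_∈ Γ S) (symmetric u v) uv∈Γ

    -- Each of the three colours gives its own neighbour of `v`, and `p` excludes at most one of
    -- them. If `v ≡ p`, the diagonal value excludes at most one colour as well.
    two-onward : 3 ≤ γ F S → ∀ p v → ∃[ a ] ∃[ b ] (a ≢ p × b ≢ p × b ≢ a × Adj v a × Adj v b)
    two-onward 3≤γ p v
      with missed-value (colour v) ⁅ p ⁆ (Γ S)
             (<-≤-trans (s≤s (≤-reflexive (∣⁅x⁆∣≡1 p))) (≤-trans (n≤1+n 2) 3≤γ))
    ... | c , c∈Γ , c-new with partner v c
    ... | a , v≢a , refl
      with missed-value (colour v) (⁅ p ⁆ ∪ ⁅ a ⁆) (Γ S)
             (<-≤-trans (s≤s (≤-reflexive (∣⁅x⁆∪⁅y⁆∣≡2 a≢p))) 3≤γ)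
      where
      a≢p : a ≢ p
      a≢p refl = c-new (x∈⁅x⁆ p) refl
    ... | d , d∈Γ , d-new with partner v d
    ... | b , v≢b , refl =
      a , b , (λ { refl → c-new (x∈⁅x⁆ p) refl }) ,
      (λ { refl → d-new (p⊆p∪q ⁅ a ⁆ (x∈⁅x⁆ p)) refl }) ,
      (λ { refl → d-new (x∈p∪⁅x⁆ ⁅ p ⁆ a) refl }) ,
      (v≢a , c∈Γ) , (v≢b , d∈Γ)

    -- A colour of `S` is also a colour of the current set, so every attachment is along a link and
    -- the surplus survives.
    attached-surplus : ∀ {e i X} → Surplus e S → Attached Adj S i X →
                       ∣ X ∣ ≡ i + ∣ S ∣ × S ⊆ X × Surplus e X
    attached-surplus surplus start = refl , id , surplus
    attached-surplus surplus (attach {X = X} {u} {y} att y∉X u∈X (_ , uy∈Γ))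
      with attached-surplus surplus att
    ... | size , S⊆X , surplusX =
      trans (∣p∪⁅x⁆∣≡1+∣p∣ X y∉X) (cong suc size) , p⊆p∪q ⁅ y ⁆ ∘ S⊆X ,
      surplus-link surplusX y∉X u∈X (coloursIn-mono S⊆X uy∈Γ)

    -- If the search over all subsets fails, then no double link can occur, since attaching its
    -- vertex would give a `Y` as sought. That is `unique-link`, and it yields `2 ^ r` distinct walk
    -- endpoints among fewer vertices.
    surplus-step : ∀ {e} r → n < 2 ^ r → Nonempty S → ∣ S ∣ ≤ γ F S → 3 ≤ γ F S → Surplus e S →
                   ∃[ Y ] (∣ S ∣ ≤ ∣ Y ∣ × ∣ Y ∣ ≤ suc (r + r) + ∣ S ∣ × Surplus (suc e) Y)
    surplus-step {e} r n<2^r (u , u∈S) ∣S∣≤γ 3≤γ surplus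
      with anySubset? (λ Y → (∣ S ∣ ≤? ∣ Y ∣) ×-dec (∣ Y ∣ ≤? suc (r + r) + ∣ S ∣)
                             ×-dec surplus? (suc e) Y)
    ... | yes found = found
    ... | no ∄Y with escape u∈S ∣S∣≤γ
    -- `M` is `suc (r + r)`: trees of depth `r` need `r + r < M`, and a double link after `i < M`
    -- attachments gives a set of at most `M + ∣ S ∣` vertices.
    ... | y , y∉S , uy with walk-endpoints Adj (λ (u≢u , _) → u≢u refl) adj-sym (two-onward 3≤γ)
                             S (suc (r + r)) unique-link r start ≤-refl u∈S y∉S uy
      where
      unique-link : ∀ {i X y u v} → Attached Adj S i X → i < suc (r + r) → y ∉ X →
                    u ∈ X → v ∈ X → Adj u y → Adj v y → u ≡ v
      unique-link {i} {X} {y} {u} {v} att i<M y∉X u∈X v∈X (_ , uy∈Γ) (_ , vy∈Γ)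
        with attached-surplus surplus att
      ... | size , S⊆X , surplusX = decidable-stable (u ≟ v) λ u≢v →
        ∄Y (X ∪ ⁅ y ⁆ ,
            ≤-trans (m≤n+m ∣ S ∣ (suc i)) (≤-reflexive (sym size′)) ,
            ≤-trans (≤-reflexive size′) (+-monoˡ-≤ ∣ S ∣ i<M) ,
            surplus-double-link surplusX y∉X u∈X v∈X (≢-sym u≢v)
              (coloursIn-mono S⊆X uy∈Γ) (coloursIn-mono S⊆X vy∈Γ))
        where
        size′ : ∣ X ∪ ⁅ y ⁆ ∣ ≡ suc i + ∣ S ∣
        size′ = trans (∣p∪⁅x⁆∣≡1+∣p∣ X y∉X) (cong suc size)
    ... | R , 2^r≤∣R∣ , _ = contradiction n<2^r (≤⇒≯ (≤-trans 2^r≤∣R∣ (∣p∣≤n R)))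

  -- With fewer colours than vertices and `e ≤ ∣ X ∣`, the left side of `Surplus (suc e) X` is at
  -- most `3 * ∣ X ∣`, which `3k≤kC2` absorbs.
  many-colours : ∀ {e X} → ¬ Surplus (suc e) X → 7 + e ≤ ∣ X ∣ → ∣ X ∣ ≤ γ F X
  many-colours {e} {X} ¬surplus 7+e≤k = ≮⇒≥ λ γ<k → ¬surplus (begin
    γ F X + (k + suc e)   ≡⟨ lemma (γ F X) k e ⟩
    suc (γ F X) + (k + e) ≤⟨ +-mono-≤ γ<k (+-monoʳ-≤ k (m+n≤o⇒n≤o 7 7+e≤k)) ⟩
    k + (k + k)           ≡⟨ lemma′ k ⟩
    3 * k                 ≤⟨ 3k≤kC2 (m+n≤o⇒m≤o 7 7+e≤k) ⟩
    k C 2                 ≤⟨ m≤m+n (k C 2) 3 ⟩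
    k C 2 + 3             ∎)
    where
    open ≤-Reasoning
    k = ∣ X ∣
    lemma : ∀ g k e → g + (k + suc e) ≡ suc g + (k + e)
    lemma = solve-∀
    lemma′ : ∀ k → k + (k + k) ≡ 3 * k
    lemma′ = solve-∀

  surplus-next : ∀ {e X} r → n < 2 ^ r → 7 + e ≤ ∣ X ∣ → Surplus e X →
                 ∃[ Y ] (∣ X ∣ ≤ ∣ Y ∣ × ∣ Y ∣ ≤ suc (r + r) + ∣ X ∣ × Surplus (suc e) Y)
  surplus-next {e} {X} r n<2^r 7+e≤∣X∣ surplus with surplus? (suc e) X
  ... | yes surplus′ = X , ≤-refl , m≤n+m ∣ X ∣ (suc (r + r)) , surplus′
  ... | no ¬surplus′ = surplus-step X r n<2^r X-nonempty k≤γ 3≤γ surplus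
    where
    k≤γ : ∣ X ∣ ≤ γ F X
    k≤γ = many-colours ¬surplus′ 7+e≤∣X∣
    3≤γ : 3 ≤ γ F X
    3≤γ = ≤-trans (m+n≤o⇒m≤o 3 7+e≤∣X∣) k≤γ
    X-nonempty : Nonempty X
    X-nonempty = decidable-stable (nonempty? X) λ empty → contradiction
      (subst (7 + e ≤_) (trans (cong ∣_∣ (Empty-unique empty)) (∣⊥∣≡0 n)) 7+e≤∣X∣) λ ()

  -- Starting with `7 + a` vertices meets the size requirement `7 + e` of every round up to `a`;
  -- each round adds at most `suc (r + r)`. The argument `6 + a` appears because `surplus-of-size`
  -- takes the size minus one.
  surplus-iterate : ∀ r a → n < 2 ^ r → 7 + a ≤ n → ∀ e → e ≤ a →
                    ∃[ X ] (7 + a ≤ ∣ X ∣ × ∣ X ∣ ≤ e * suc (r + r) + (7 + a) × Surplus e X)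
  surplus-iterate r a n<2^r 7+a≤n zero _ =
    let X , size , _ , surplus = surplus-of-size (6 + a) 7+a≤n
    in X , ≤-reflexive (sym size) , ≤-reflexive size , surplus
  surplus-iterate r a n<2^r 7+a≤n (suc e) e<a =
    let X , 7+a≤∣X∣ , ∣X∣≤ , surplus = surplus-iterate r a n<2^r 7+a≤n e (<⇒≤ e<a)
        Y , ∣X∣≤∣Y∣ , ∣Y∣≤ , surplus′ =
          surplus-next r n<2^r (≤-trans (+-monoʳ-≤ 7 (<⇒≤ e<a)) 7+a≤∣X∣) surplus
    in Y , ≤-trans 7+a≤∣X∣ ∣X∣≤∣Y∣ ,
       ≤-trans ∣Y∣≤ (≤-trans (+-monoʳ-≤ (suc (r + r)) ∣X∣≤)
         (≤-reflexive (sym (+-assoc (suc (r + r)) (e * suc (r + r)) (7 + a))))) ,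
       surplus′

-- Logarithmic size bounds and the return to integer deficits

n<2^[1+⌊log₂n⌋] : ∀ n → n < 2 ^ suc ⌊log₂ n ⌋
n<2^[1+⌊log₂n⌋] n = ≰⇒> λ 2^r≤n →
  1+n≰n (subst (_≤ ⌊log₂ n ⌋) (⌊log₂[2^n]⌋≡n (suc ⌊log₂ n ⌋)) (⌊log₂⌋-mono-≤ 2^r≤n))

-- Here `l` stands for `⌊log₂ n ⌋` and the walks have length `suc l`. As `1 ≤ l`, the additive
-- constants are absorbed into multiples of `l`.
size-bound : ∀ a {l} → 1 ≤ l → a * suc (suc l + suc l) + (7 + a) ≤ (a * 5 + (7 + a)) * l
size-bound a {l} 1≤l = begin
  a * suc (suc l + suc l) + (7 + a)   ≤⟨ +-mono-≤ (*-monoʳ-≤ a 2l+3≤5l) (m≤m*n (7 + a) l {{>-nonZero 1≤l}}) ⟩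
  a * (5 * l) + (7 + a) * l           ≡⟨ cong (_+ (7 + a) * l) (*-assoc a 5 l) ⟨
  a * 5 * l + (7 + a) * l             ≡⟨ *-distribʳ-+ l (a * 5) (7 + a) ⟨
  (a * 5 + (7 + a)) * l               ∎
  where
  open ≤-Reasoning
  lemma : ∀ l → suc (suc l + suc l) ≡ (l + l) + 3 * 1
  lemma = solve-∀
  lemma′ : ∀ l → (l + l) + 3 * l ≡ 5 * l
  lemma′ = solve-∀
  2l+3≤5l : suc (suc l + suc l) ≤ 5 * l
  2l+3≤5l = begin
    suc (suc l + suc l)   ≡⟨ lemma l ⟩
    (l + l) + 3 * 1       ≤⟨ +-monoʳ-≤ (l + l) (*-monoʳ-≤ 3 1≤l) ⟩
    (l + l) + 3 * l       ≡⟨ lemma′ l ⟩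
    5 * l                 ∎

-- Out of scope above, where _∣_ would make sums of cardinalities ∣_∣ parse ambiguously.
open import Data.Integer as ℤ using (ℤ; +_)
import Data.Integer.Properties as ℤ
import Data.Integer.Tactic.RingSolver as ℤ-Solver
open import Data.Nat.Divisibility using (_∣_)

-- The 3 is the offset built into `Surplus`. Part (i) takes `d` as -3 with `a` zero; part (ii) takes
-- `a` as `d + 3`.
surplus⇒deficit : ∀ {a n X} (F : OneFactorization n) (d : ℤ) → d ℤ.+ + 3 ℤ.≤ + a →
                  Surplus F a X → + ∣ X ∣ ℤ.+ d ℤ.≤ deficit F X
surplus⇒deficit {a} {n} {X} F d d+3≤a surplus = begin
  + k ℤ.+ d                                             ≡⟨ lemma (+ k) d (+ g) ⟩
  (+ g ℤ.+ (+ k ℤ.+ (d ℤ.+ + 3))) ℤ.- (+ 3 ℤ.+ + g)     ≤⟨ ℤ.+-monoˡ-≤ (ℤ.- (+ 3 ℤ.+ + g)) (ℤ.+-monoʳ-≤ (+ g) (ℤ.+-monoʳ-≤ (+ k) d+3≤a)) ⟩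
  + (g + (k + a)) ℤ.- (+ 3 ℤ.+ + g)                     ≤⟨ ℤ.+-monoˡ-≤ (ℤ.- (+ 3 ℤ.+ + g)) (ℤ.+≤+ surplus) ⟩
  + (c + 3) ℤ.- (+ 3 ℤ.+ + g)                           ≡⟨ lemma′ (+ c) (+ g) ⟩
  + c ℤ.- + g                                           ∎
  where
  open ℤ.≤-Reasoning
  k g c : ℕ
  k = ∣ X ∣
  g = γ F X
  c = k C 2
  lemma : ∀ k d g → k ℤ.+ d ≡ (g ℤ.+ (k ℤ.+ (d ℤ.+ + 3))) ℤ.- (+ 3 ℤ.+ g)
  lemma = ℤ-Solver.solve-∀
  lemma′ : ∀ c g → (c ℤ.+ + 3) ℤ.- (+ 3 ℤ.+ g) ≡ c ℤ.- g
  lemma′ = ℤ-Solver.solve-∀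

theorem4 : (∀ (n : ℕ) → 2 ∣ n → ∀ (k : ℕ) → 4 ≤ k → k ≤ n →
    ∀ (F : OneFactorization n) →
    ∃[ S ] (∣ S ∣ ≡ k × (+ k ℤ.- + 3) ℤ.≤ deficit F S))
    ×
    (∀ (d : ℤ) → (ℤ.- + 2) ℤ.≤ d →
    ∃[ C ] ∃[ n₀ ] (0 < C ×
    (∀ (n : ℕ) → 2 ∣ n → n₀ ≤ n →
    ∀ (F : OneFactorization n) →
    ∃[ k ] ∃[ S ] (1 ≤ k × k ≤ C * ⌊log₂ n ⌋ × ∣ S ∣ ≡ k × (+ k ℤ.+ d) ℤ.≤ deficit F S))))
theorem4 = part-i , part-ii
  where
  part-i : ∀ (n : ℕ) → 2 ∣ n → ∀ (k : ℕ) → 4 ≤ k → k ≤ n →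
    ∀ (F : OneFactorization n) →
    ∃[ S ] (∣ S ∣ ≡ k × (+ k ℤ.- + 3) ℤ.≤ deficit F S)
  part-i n _ (suc k) _ k<n F with surplus-of-size F k k<n
  ... | S , size , _ , surplus =
    S , size , subst (λ j → + j ℤ.- + 3 ℤ.≤ deficit F S) size (surplus⇒deficit F (ℤ.- + 3) ℤ.≤-refl surplus)

  part-ii : ∀ (d : ℤ) → (ℤ.- + 2) ℤ.≤ d →
    ∃[ C ] ∃[ n₀ ] (0 < C ×
    (∀ (n : ℕ) → 2 ∣ n → n₀ ≤ n →
    ∀ (F : OneFactorization n) →
    ∃[ k ] ∃[ S ] (1 ≤ k × k ≤ C * ⌊log₂ n ⌋ × ∣ S ∣ ≡ k × (+ k ℤ.+ d) ℤ.≤ deficit F S)))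
  part-ii d -2≤d = C , 7 + a , ≤-trans (s≤s z≤n) (m≤n+m (7 + a) (a * 5)) , large
    where
    a C : ℕ
    -- From `d ≥ -2` the absolute value is `d + 3` itself; it is also the number of rounds.
    a = ℤ.∣ d ℤ.+ + 3 ∣
    C = a * 5 + (7 + a)
    d+3≤a : d ℤ.+ + 3 ℤ.≤ + a
    d+3≤a = ℤ.≤-reflexive (sym (ℤ.0≤i⇒+∣i∣≡i (ℤ.≤-trans (ℤ.+≤+ z≤n) (ℤ.+-monoˡ-≤ (+ 3) -2≤d))))
    large : ∀ (n : ℕ) → 2 ∣ n → 7 + a ≤ n → ∀ (F : OneFactorization n) →
      ∃[ k ] ∃[ S ] (1 ≤ k × k ≤ C * ⌊log₂ n ⌋ × ∣ S ∣ ≡ k × (+ k ℤ.+ d) ℤ.≤ deficit F S)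
    large n _ 7+a≤n F
      with surplus-iterate F (suc ⌊log₂ n ⌋) a (n<2^[1+⌊log₂n⌋] n) 7+a≤n a ≤-refl
    ... | S , 7+a≤∣S∣ , ∣S∣≤ , surplus =
      ∣ S ∣ , S , ≤-trans (s≤s z≤n) 7+a≤∣S∣ , ≤-trans ∣S∣≤ (size-bound a 1≤log) , refl ,
      surplus⇒deficit F d d+3≤a surplus
      where
      1≤log : 1 ≤ ⌊log₂ n ⌋
      1≤log = ⌊log₂⌋-mono-≤ {2} (≤-trans (s≤s (s≤s z≤n)) 7+a≤n)
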